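{- There is an algorithm that, given two strings $A$ and $B$ each of length at most $n$, computes a minimal common supersequence of $A$ and $B$ in $O(n)$ time.
   Context: $X\subseteq S$ means $X$ is a (not necessarily contiguous) subsequence of $S$. A common supersequence of $A$ and $B$ is a string $C$ with $A\subseteq C$ and $B\subseteq C$; it is minimal if no proper subsequence of $C$ is a common supersequence of $A$ and $B$. Time is measured in the standard RAM model with $O(1)$-time character comparisons. -}

module Defs where

open import Data.Bool.Base using (Bool; true; false; if_then_else_)
open import Data.Fin.Base using (toℕ)
open import Data.List.Base using (List; []; _∷_; _++_; length; lookup; map; drop; head)
open import Data.List.Relation.Binary.Sublist.Propositional using (_⊆_)
open import Data.Maybe.Base using (Maybe; just; nothing; fromMaybe; _>>=_)
open import Data.Nat.Base using (ℕ; zero; suc; _+_; _*_; _∸_; _^_; _≤_; _≡ᵇ_; _<ᵇ_)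
open import Data.Nat.Properties using (_<?_)
open import Data.Product.Base using (_×_; ∃-syntax)
open import Relation.Binary.Definitions using (DecidableEquality)
open import Relation.Binary.PropositionalEquality.Core using (_≡_; _≢_)
open import Relation.Nullary.Decidable.Core using (does)
open import Relation.Nullary.Negation.Core using (¬_)

CommonSupersequence : {Σ : Set} → List Σ → List Σ → List Σ → Set
CommonSupersequence A B C = A ⊆ C × B ⊆ C

-- Minimal with respect to the subsequence order (not shortest).
MinimalCommonSupersequence : {Σ : Set} → List Σ → List Σ → List Σ → Set
MinimalCommonSupersequence A B C =
  CommonSupersequence A B C ×
  (∀ C′ → C′ ⊆ C → C′ ≢ C → ¬ CommonSupersequence A B C′)

infix 4 _∈O_

_∈O_ : (ℕ → ℕ) → (ℕ → ℕ) → Set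
f ∈O g = ∃[ c ] ∃[ n₀ ] (∀ n → n₀ ≤ n → f n ≤ c * g n)

-- A random access machine with unit-cost instructions.  r, i, j are register
-- numbers, k is a literal and l a position in the program.  Instructions do not
-- mention the alphabet, so one program serves all alphabets: characters can
-- only be copied and tested for equality.
data Instr : Set where
  const   : (r k : ℕ) → Instr
  move    : (r i : ℕ) → Instr
  add sub : (r i j : ℕ) → Instr
  load    : (r i : ℕ) → Instr       -- reg r := mem (reg i)
  store   : (i r : ℕ) → Instr       -- mem (reg i) := reg r
  jump    : (l : ℕ) → Instr
  jeq     : (i j l : ℕ) → Instr     -- jump if equal: two numbers or two characters
  jlt     : (i j l : ℕ) → Instr     -- jump if less: two numbers
  halt    : Instr

Program : Set
Program = List Instr

data Cell (Σ : Set) : Set where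
  num : ℕ → Cell Σ
  chr : Σ → Cell Σ

record State (Σ : Set) : Set where
  constructor ⟨_,_,_⟩
  field
    pc  : ℕ
    reg : ℕ → Cell Σ
    mem : ℕ → Cell Σ

open State public

_[_≔_] : {X : Set} → (ℕ → X) → ℕ → X → (ℕ → X)
(f [ i ≔ x ]) j = if i ≡ᵇ j then x else f j

fetch : Program → ℕ → Maybe Instr
fetch P l = head (drop l P)

-- The machine has word size w: an instruction producing a number that does not
-- fit into w bits is stuck (nothing), and so is one applied to operands of the
-- wrong kind.
module Machine {Σ : Set} (_≟_ : DecidableEquality Σ) (w : ℕ) where

  word : ℕ → Maybe (Cell Σ)
  word k = if does (k <? 2 ^ w) then just (num k) else nothing

  number : Cell Σ → Maybe ℕ
  number (num k) = just k
  number (chr _) = nothing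

  equal : Cell Σ → Cell Σ → Maybe Bool
  equal (num x) (num y) = just (x ≡ᵇ y)
  equal (chr a) (chr b) = just (does (a ≟ b))
  equal (num _) (chr _) = nothing
  equal (chr _) (num _) = nothing

  setReg : ℕ → Cell Σ → State Σ → State Σ
  setReg r v s = ⟨ suc (pc s) , reg s [ r ≔ v ] , mem s ⟩

  setMem : ℕ → Cell Σ → State Σ → State Σ
  setMem a v s = ⟨ suc (pc s) , reg s , mem s [ a ≔ v ] ⟩

  goto : ℕ → State Σ → State Σ
  goto l s = ⟨ l , reg s , mem s ⟩

  branch : Bool → ℕ → State Σ → State Σ
  branch b l s = goto (if b then l else suc (pc s)) s

  exec : Instr → State Σ → Maybe (State Σ)
  exec (const r k) s = do
    v ← word k
    just (setReg r v s)
  exec (move r i) s = just (setReg r (reg s i) s)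
  exec (add r i j) s = do
    x ← number (reg s i)
    y ← number (reg s j)
    v ← word (x + y)
    just (setReg r v s)
  exec (sub r i j) s = do
    x ← number (reg s i)
    y ← number (reg s j)
    v ← word (x ∸ y)
    just (setReg r v s)
  exec (load r i) s = do
    a ← number (reg s i)
    just (setReg r (mem s a) s)
  exec (store i r) s = do
    a ← number (reg s i)
    just (setMem a (reg s r) s)
  exec (jump l) s = just (goto l s)
  exec (jeq i j l) s = do
    b ← equal (reg s i) (reg s j)
    just (branch b l s)
  exec (jlt i j l) s = do
    x ← number (reg s i)
    y ← number (reg s j)
    just (branch (x <ᵇ y) l s)
  exec halt s = nothing

  step : Program → State Σ → Maybe (State Σ)
  step P s = do
    ins ← fetch P (pc s)
    exec ins s

  -- P ⊢ s ⇓[ t ] s′ : started in s, the program P executes t instructions, the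
  -- last of which is halt, and ends in s′.
  data _⊢_⇓[_]_ (P : Program) : State Σ → ℕ → State Σ → Set where
    stop : ∀ {s} → fetch P (pc s) ≡ just halt → P ⊢ s ⇓[ 1 ] s
    next : ∀ {s s′ s″ t} → step P s ≡ just s′ → P ⊢ s′ ⇓[ t ] s″ →
           P ⊢ s ⇓[ suc t ] s″

-- Cells not listed hold the number 0.
contents : {Σ : Set} → List (Cell Σ) → ℕ → Cell Σ
contents cs a = fromMaybe (num 0) (head (drop a cs))

-- Registers 0 and 1 hold the two lengths; A is stored at addresses
-- 0 , … , |A| - 1 and B directly after it.
input : {Σ : Set} → List Σ → List Σ → State Σ
input A B = ⟨ 0 , contents (num (length A) ∷ num (length B) ∷ [])
                , contents (map chr (A ++ B)) ⟩

-- Register 0 holds the length of the output string, register 1 the address of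
-- its first character.
HasOutput : {Σ : Set} → State Σ → List Σ → Set
HasOutput s C =
  reg s 0 ≡ num (length C) ×
  ∃[ base ] (reg s 1 ≡ num base ×
             (∀ i → mem s (base + toℕ i) ≡ chr (lookup C i)))

-- If j is least such that A[j..] ⊆ B[k..] and k is greatest such that
-- B[..k] ⊆ A[..j], then A[..j] ++ B[k..] is a minimal common supersequence.  For
-- a common supersequence inside it splits as P ++ Q with P ⊆ A[..j] and
-- Q ⊆ B[k..]; the part of A that goes into Q has length at most |A| - j, so
-- |P| ≥ j and P = A[..j], and symmetrically Q = B[k..].
--
-- Write F k for the least j belonging to k.  Matching A greedily from the right
-- while scanning B from the right tabulates F.  Then j grows from 0, while k
-- counts the prefix of B matched greedily in A[..j]; since F is monotone,
-- j ≤ F k is preserved, and the scan stops at the first j with j = F k.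
module Submission where

open import Data.Bool.Base using (true; if_then_else_)
open import Data.Empty using (⊥-elim)
open import Data.Fin.Base as Fin using (toℕ)
open import Data.List.Base
  using (List; []; _∷_; _++_; _ʳ++_; length; lookup; map; drop; reverse; foldr)
open import Data.List.Properties
  using (++-assoc; drop-drop; length-++; length-ʳ++; length-reverse; ʳ++-defn; ʳ++-ʳ++;
    ++-ʳ++; map-ʳ++; length-map; ∷-injectiveˡ; ∷-injectiveʳ; ++-identityʳ;
    reverse-involutive; reverse-++)
open import Data.List.Relation.Binary.Pointwise using (Pointwise-≡⇒≡)
open import Data.List.Relation.Binary.Sublist.Heterogeneous.Properties using (toPointwise)
open import Data.List.Relation.Binary.Sublist.Propositional
  using (_⊆_; []; _∷_; _∷ʳ_; ⊆-refl; ⊆-trans)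
open import Data.List.Relation.Binary.Sublist.Propositional.Properties
  using (length-mono-≤; ++⁺; reverse⁺)
open import Data.Maybe.Base using (just)
open import Data.Nat.Base using (ℕ; suc; _+_; _*_; _∸_; _^_; _≤_; _<_; z≤n; s≤s)
open import Data.Nat.Properties as ℕ using (module ≤-Reasoning)
open import Data.Nat.Solver using (module +-*-Solver)
open import Data.Product.Base using (_×_; _,_; proj₁; proj₂; ∃-syntax)
open import Defs
open import Function.Base using (_∘_)
open import Relation.Binary.Definitions using (DecidableEquality)
open import Relation.Binary.PropositionalEquality
  using (_≡_; _≢_; refl; sym; trans; cong; cong₂; subst; subst₂; ≢-sym;
    module ≡-Reasoning)
open import Relation.Nullary.Decidable using (Dec; does; yes; no; dec-true; dec-false)

private
  variable
    X : Set

-- Zippers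

-- A position in a string is a splitting `xs ʳ++ ys` whose left part is kept reversed. Moving one
-- character to the right conses it onto `xs`, and the equation for the whole string stays the same
-- definitionally.
ʳ++-injectiveʳ : (xs xs′ : List X) {ys ys′ : List X} → length xs ≡ length xs′ →
                 xs ʳ++ ys ≡ xs′ ʳ++ ys′ → ys ≡ ys′
ʳ++-injectiveʳ []       []         _  eq = eq
ʳ++-injectiveʳ (_ ∷ xs) (_ ∷ xs′) len eq =
  ∷-injectiveʳ (ʳ++-injectiveʳ xs xs′ (ℕ.suc-injective len) eq)

ʳ++-injectiveˡ : (xs xs′ : List X) {ys ys′ : List X} → length xs ≡ length xs′ →
                 xs ʳ++ ys ≡ xs′ ʳ++ ys′ → xs ≡ xs′
ʳ++-injectiveˡ []       []         _   _  = refl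
ʳ++-injectiveˡ (_ ∷ xs) (_ ∷ xs′) len eq =
  cong₂ _∷_ (∷-injectiveˡ (ʳ++-injectiveʳ xs xs′ (ℕ.suc-injective len) eq))
            (ʳ++-injectiveˡ xs xs′ (ℕ.suc-injective len) eq)

-- The position lies within `zs`, so its character does not depend on what follows `zs`. This
-- carries positions of the output that fall into A[..j] over to `A`.
ʳ++-replace : (xs zs : List X) {y : X} {ys Q Q′ : List X} → length xs < length zs →
              xs ʳ++ y ∷ ys ≡ zs ʳ++ Q → ∃[ ys′ ] (xs ʳ++ y ∷ ys′ ≡ zs ʳ++ Q′)
ʳ++-replace xs (z ∷ zs) xs<zs eq with length xs ℕ.≟ length zs
... | no differ = ʳ++-replace xs zs (ℕ.≤∧≢⇒< (ℕ.≤-pred xs<zs) differ) eq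
... | yes same  = _ , cong₂ (λ us u → us ʳ++ u ∷ _)
  (ʳ++-injectiveˡ xs zs same eq) (∷-injectiveˡ (ʳ++-injectiveʳ xs zs same eq))

-- Matching `A` from the right is matching `reverse A`; this reads the resulting zipper as one of
-- `A`.
ʳ++-flip : (xs : List X) {ys zs : List X} → xs ʳ++ ys ≡ reverse zs → ys ʳ++ xs ≡ zs
ʳ++-flip xs {ys} {zs} eq = begin
  ys ʳ++ xs             ≡⟨ cong (ys ʳ++_) (++-identityʳ xs) ⟨
  ys ʳ++ xs ++ []       ≡⟨ ʳ++-ʳ++ xs ⟨
  reverse (xs ʳ++ ys)   ≡⟨ cong reverse eq ⟩
  reverse (reverse zs)  ≡⟨ reverse-involutive zs ⟩
  zs                    ∎
  where open ≡-Reasoning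

length-zipper : (xs : List X) {ys zs : List X} → xs ʳ++ ys ≡ zs →
                length xs + length ys ≡ length zs
length-zipper xs refl = sym (length-ʳ++ xs)

length-left : (xs : List X) {ys zs : List X} → xs ʳ++ ys ≡ zs → length xs ≤ length zs
length-left xs eq = subst (length xs ≤_) (length-zipper xs eq) (ℕ.m≤m+n _ _)

length-left-∷ : (xs : List X) {y : X} {ys zs : List X} → xs ʳ++ y ∷ ys ≡ zs →
                length xs < length zs
length-left-∷ xs {y} = length-left (y ∷ xs)

drop-ʳ++ : (xs : List X) {ys : List X} → drop (length xs) (xs ʳ++ ys) ≡ ys
drop-ʳ++ []            = refl
drop-ʳ++ (x ∷ xs) {ys} = begin
  drop (1 + length xs) (xs ʳ++ x ∷ ys)         ≡⟨ cong (λ k → drop k (xs ʳ++ x ∷ ys)) (ℕ.+-comm 1 _) ⟩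
  drop (length xs + 1) (xs ʳ++ x ∷ ys)         ≡⟨ drop-drop (length xs) 1 _ ⟨
  drop 1 (drop (length xs) (xs ʳ++ x ∷ ys))    ≡⟨ cong (drop 1) (drop-ʳ++ xs) ⟩
  ys                                           ∎
  where open ≡-Reasoning

-- Subsequences

⊆-++-split : (P : List X) {S Q : List X} → S ⊆ P ++ Q →
             ∃[ U ] ∃[ V ] (U ++ V ≡ S × U ⊆ P × V ⊆ Q)
⊆-++-split []      τ          = [] , _ , refl , [] , τ
⊆-++-split (p ∷ P) (.p ∷ʳ τ) =
  let U , V , eq , σ , σ′ = ⊆-++-split P τ in U , V , eq , p ∷ʳ σ , σ′
⊆-++-split (p ∷ P) (refl ∷ τ) =
  let U , V , eq , σ , σ′ = ⊆-++-split P τ in p ∷ U , V , cong (p ∷_) eq , refl ∷ σ , σ′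

⊆-long⇒≡ : {S T : List X} → S ⊆ T → length T ≤ length S → S ≡ T
⊆-long⇒≡ τ T≤S = Pointwise-≡⇒≡ (toPointwise (ℕ.≤-antisym (length-mono-≤ τ) T≤S) τ)

-- Both extremality hypotheses compare lengths over all splittings, because length bounds are what
-- turn `P′ ⊆ P` and `Q′ ⊆ Q` into equalities.
minimal-glue : {A B P A′ B′ Q : List X} → P ++ A′ ≡ A → B′ ++ Q ≡ B → A′ ⊆ Q → B′ ⊆ P →
               (∀ U V → U ++ V ≡ A → V ⊆ Q → length P ≤ length U) →
               (∀ U V → U ++ V ≡ B → U ⊆ P → length Q ≤ length V) →
               MinimalCommonSupersequence A B (P ++ Q)
minimal-glue {A = A} {B} {P} {A′} {B′} {Q} refl refl A′⊆Q B′⊆P leastA leastB =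
  (++⁺ ⊆-refl A′⊆Q , ++⁺ B′⊆P ⊆-refl) ,
  λ C′ C′⊆C C′≢C (A⊆C′ , B⊆C′) → C′≢C (equal C′⊆C A⊆C′ B⊆C′)
  where
  equal : ∀ {C′} → C′ ⊆ P ++ Q → A ⊆ C′ → B ⊆ C′ → C′ ≡ P ++ Q
  equal C′⊆C A⊆C′ B⊆C′ with ⊆-++-split P C′⊆C
  ... | P′ , Q′ , refl , P′⊆P , Q′⊆Q with ⊆-++-split P′ A⊆C′ | ⊆-++-split P′ B⊆C′
  ... | U , V , eqA , U⊆P′ , V⊆Q′ | U₂ , V₂ , eqB , U₂⊆P′ , V₂⊆Q′ =
    cong₂ _++_
      (⊆-long⇒≡ P′⊆P (ℕ.≤-trans (leastA U V eqA (⊆-trans V⊆Q′ Q′⊆Q)) (length-mono-≤ U⊆P′)))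
      (⊆-long⇒≡ Q′⊆Q (ℕ.≤-trans (leastB U₂ V₂ eqB (⊆-trans U₂⊆P′ P′⊆P)) (length-mono-≤ V₂⊆Q′)))

-- Greedy matching

module Greedy {Σ : Set} (_≟_ : DecidableEquality Σ) where

  consume : Σ → List Σ × List Σ → List Σ × List Σ
  consume b ([]    , M) = [] , M
  consume b (x ∷ R , M) = if does (x ≟ b) then (R , x ∷ M) else (x ∷ R , M)

  -- embed S T = (R , M): reading T from right to left, the prefix of S that is
  -- matched is M reversed, and R remains.
  embed : List Σ → List Σ → List Σ × List Σ
  embed S = foldr consume (S , [])

  consume-match : ∀ {b x R M} → x ≡ b → consume b (x ∷ R , M) ≡ (R , x ∷ M)
  consume-match {b} {x} p rewrite dec-true (x ≟ b) p = refl

  consume-skip : ∀ {b x R M} → x ≢ b → consume b (x ∷ R , M) ≡ (x ∷ R , M)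
  consume-skip {b} {x} p rewrite dec-false (x ≟ b) p = refl

  -- `M` is a reversed prefix of `S`, and so is `V`, so one notion serves both directions. For
  -- `S = reverse A` it describes the longest suffix of `A` embedding in `T`; for `S = B` and `T` a
  -- reversed prefix of `A`, the longest prefix of `B` embedding in that prefix.
  record Matched (S T R M : List Σ) : Set where
    field
      splits   : M ʳ++ R ≡ S
      embeds   : M ⊆ T
      greatest : ∀ {U V} → V ʳ++ U ≡ S → V ⊆ T → length V ≤ length M

  consume-matched : ∀ {S T R M} b → Matched S T R M →
                    Matched S (b ∷ T) (proj₁ (consume b (R , M))) (proj₂ (consume b (R , M)))
  consume-matched {R = []} {M} b m = record
    { splits   = splits
    ; embeds   = b ∷ʳ embeds
    ; greatest = λ {_} {V} eq _ → ℕ.≤-trans (length-left V eq)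
        (ℕ.≤-reflexive (trans (sym (length-zipper M splits)) (ℕ.+-identityʳ _)))
    }
    where open Matched m
  consume-matched {S} {T} {x ∷ R} {M} b m with x ≟ b
  ... | yes refl = record
    { splits   = splits
    ; embeds   = refl ∷ embeds
    ; greatest = λ { eq (_ ∷ʳ τ)   → ℕ.m≤n⇒m≤1+n (greatest eq τ)
                   ; eq (refl ∷ τ) → s≤s (greatest eq τ) }
    }
    where open Matched m
  ... | no x≢b = record
    { splits   = splits
    ; embeds   = b ∷ʳ embeds
    ; greatest = λ { eq (_ ∷ʳ τ)   → greatest eq τ
                   -- If `V` were as long as `M`, both would end at the same position of `S`, and
                   -- the next character would be `b` as well as `x`.
                   ; {V = _ ∷ V} eq (refl ∷ τ) → ℕ.≤∧≢⇒< (greatest eq τ) λ len →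
                       x≢b (sym (∷-injectiveˡ (ʳ++-injectiveʳ V M len (trans eq (sym splits))))) }
    }
    where open Matched m

  embed-matched : ∀ S T {R M} → embed S T ≡ (R , M) → Matched S T R M
  embed-matched S []      refl = record
    { splits = refl ; embeds = [] ; greatest = λ { _ [] → z≤n } }
  embed-matched S (b ∷ T) refl = consume-matched b (embed-matched S T refl)

  -- This is the monotonicity of F: one more character read can only match more of `S`.
  embed-∷-shrinks : ∀ S b T → length (proj₁ (embed S (b ∷ T))) ≤ length (proj₁ (embed S T))
  embed-∷-shrinks S b T with embed S T
  ... | []    , M = z≤n
  ... | x ∷ R , M with x ≟ b
  ...   | yes _ = ℕ.n≤1+n _
  ...   | no  _ = ℕ.≤-refl

  -- The last hypothesis on lengths is j = F k. The two zippers of `A` are then cut at the same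
  -- place, so `A′` is the greedily matched suffix `M`. The longest matched suffix of `A` and prefix
  -- of `B` become shortest complements by subtraction from the total lengths.
  minimal-at-fixpoint : ∀ {A B A′ B′ R M} D Q → D ʳ++ A′ ≡ A →
                        Matched B D Q B′ → Matched (reverse A) Q R M →
                        length D ≡ length R →
                        MinimalCommonSupersequence A B (D ʳ++ Q)
  minimal-at-fixpoint {A} {B} {A′} {B′} {R} {M} D Q eqA mB mA len =
    subst (MinimalCommonSupersequence A B) (sym (ʳ++-defn D))
      (minimal-glue (trans (sym (ʳ++-defn D)) eqA)
                    (trans (sym (ʳ++-defn B′)) B.splits)
                    (subst (_⊆ Q) (sym A′≡M) A.embeds)
                    (reverse⁺ B.embeds) leastA leastB)
    where
    module A = Matched mA
    module B = Matched mB
    open ≤-Reasoning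

    A′≡M : A′ ≡ M
    A′≡M = ʳ++-injectiveʳ D R len (trans eqA (sym (ʳ++-flip M A.splits)))

    leastA : ∀ U V → U ++ V ≡ A → V ⊆ Q → length (reverse D) ≤ length U
    leastA U V eq V⊆Q = ℕ.+-cancelʳ-≤ (length V) _ _ (begin
      length (reverse D) + length V  ≡⟨ cong (_+ length V) (length-reverse D) ⟩
      length D + length V            ≤⟨ ℕ.+-monoʳ-≤ (length D) V≤M ⟩
      length D + length M            ≡⟨ cong (λ z → length D + length z) A′≡M ⟨
      length D + length A′           ≡⟨ length-zipper D eqA ⟩
      length A                       ≡⟨ cong length eq ⟨
      length (U ++ V)                ≡⟨ length-++ U ⟩
      length U + length V            ∎)
      where
      V≤M : length V ≤ length M
      V≤M = A.greatest {U = reverse U}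
        (trans (ʳ++-defn V) (trans (sym (reverse-++ U V)) (cong reverse eq))) V⊆Q

    leastB : ∀ U V → U ++ V ≡ B → U ⊆ reverse D → length Q ≤ length V
    leastB U V eq U⊆D = ℕ.+-cancelˡ-≤ (length U) _ _ (begin
      length U + length Q   ≤⟨ ℕ.+-monoˡ-≤ (length Q) U≤B′ ⟩
      length B′ + length Q  ≡⟨ length-zipper B′ B.splits ⟩
      length B              ≡⟨ cong length eq ⟨
      length (U ++ V)       ≡⟨ length-++ U ⟩
      length U + length V   ∎)
      where
      U≤B′ : length U ≤ length B′
      U≤B′ = subst (_≤ length B′) (length-reverse U)
        (B.greatest {U = V}
          (trans (ʳ++-ʳ++ U) eq)
          (subst (reverse U ⊆_) (reverse-involutive D) (reverse⁺ U⊆D)))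

-- Memory contents

≔-here : (f : ℕ → X) {i j : ℕ} {x : X} → i ≡ j → (f [ i ≔ x ]) j ≡ x
-- The test `i ≡ᵇ j` in the update is by definition the `does` of `i ℕ.≟ j`.
≔-here f {i} {j} p rewrite dec-true (i ℕ.≟ j) p = refl

≔-there : (f : ℕ → X) {i j : ℕ} {x : X} → i ≢ j → (f [ i ≔ x ]) j ≡ f j
≔-there f {i} {j} p rewrite dec-false (i ℕ.≟ j) p = refl

-- Positions are zippers instead of indices, so that the loop invariants supply them directly.
Stored : {Σ : Set} → (ℕ → Cell Σ) → ℕ → List Σ → Set
Stored μ a S = ∀ xs {y ys} → xs ʳ++ y ∷ ys ≡ S → μ (length xs + a) ≡ chr y

stored-≔ : {Σ : Set} {μ : ℕ → Cell Σ} {a p : ℕ} {v : Cell Σ} (S : List Σ) →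
           length S + a ≤ p → Stored μ a S → Stored (μ [ p ≔ v ]) a S
stored-≔ {μ = μ} {a} S below st xs eq = trans
  (≔-there μ (≢-sym (ℕ.<⇒≢ (ℕ.<-≤-trans (ℕ.+-monoˡ-< a (length-left-∷ xs eq)) below))))
  (st xs eq)

stored-contents : {Σ : Set} (xs : List Σ) {y : Σ} {ys : List Σ} →
                  contents (map chr (xs ʳ++ y ∷ ys)) (length xs) ≡ chr y
stored-contents xs {y} {ys}
  rewrite map-ʳ++ chr xs {y ∷ ys} | sym (length-map chr xs) | drop-ʳ++ (map chr xs) {chr y ∷ map chr ys} = refl

stored-left : {Σ : Set} (A B : List Σ) → Stored (contents (map chr (A ++ B))) 0 A
stored-left A B xs {y} {ys} refl
  rewrite ℕ.+-identityʳ (length xs) | ʳ++-defn xs {y ∷ ys} =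
  subst (λ z → contents (map chr z) (length xs) ≡ chr y) assoc (stored-contents xs)
  where
  assoc : xs ʳ++ y ∷ ys ++ B ≡ (reverse xs ++ y ∷ ys) ++ B
  assoc = trans (ʳ++-defn xs) (sym (++-assoc (reverse xs) (y ∷ ys) B))

stored-right : {Σ : Set} (A B : List Σ) → Stored (contents (map chr (A ++ B))) (length A) B
stored-right A B xs {y} {ys} refl =
  -- Left parts are reversed, so `A` in front of `B` appears as `reverse A` after `xs`.
  subst₂ (λ z k → contents (map chr z) k ≡ chr y) list index (stored-contents (xs ++ reverse A))
  where
  list : (xs ++ reverse A) ʳ++ y ∷ ys ≡ A ++ xs ʳ++ y ∷ ys
  list = trans (++-ʳ++ xs) (ʳ++-ʳ++ A)
  index : length (xs ++ reverse A) ≡ length xs + length A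
  index = trans (length-++ xs) (cong (length xs +_) (length-reverse A))

stored-lookup : {Σ : Set} {μ : ℕ → Cell Σ} {C : List Σ} → Stored μ 0 C →
                ∀ i → μ (toℕ i) ≡ chr (lookup C i)
stored-lookup {μ = μ} {C} st = go [] C refl
  where
  go : ∀ xs ys → xs ʳ++ ys ≡ C → ∀ i → μ (length xs + toℕ i) ≡ chr (lookup ys i)
  go xs (y ∷ ys) eq Fin.zero    = st xs eq
  go xs (y ∷ ys) eq (Fin.suc i) =
    trans (cong μ (ℕ.+-suc (length xs) (toℕ i))) (go (y ∷ xs) ys eq i)

-- Execution within a time bound

module Execution {Σ : Set} (_≟_ : DecidableEquality Σ) (w : ℕ) (P : Program)
                 (Post : State Σ → Set) where
  open Machine _≟_ w

  -- A bound replaces the exact time, so branches of different cost can share one estimate. Each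
  -- rule below puts one instruction in front of a run, and a correctness proof then follows the
  -- program text.
  Run : State Σ → ℕ → Set
  Run s b = ∃[ t ] ∃[ s′ ] (P ⊢ s ⇓[ t ] s′ × t ≤ b × Post s′)

  weaken : ∀ {s b b′} → b ≤ b′ → Run s b → Run s b′
  weaken b≤b′ (t , s′ , d , t≤b , q) = t , s′ , d , ℕ.≤-trans t≤b b≤b′ , q

  relax : ∀ {s b} k → Run s b → Run s (k + b)
  relax k = weaken (ℕ.m≤n+m _ k)

  tick : ∀ {s s′ b} → step P s ≡ just s′ → Run s′ b → Run s (suc b)
  tick e (t , s″ , d , t≤b , q) = suc t , s″ , next e d , s≤s t≤b , q

  word-fits : ∀ {k} → k < 2 ^ w → word k ≡ just (num k)
  word-fits {k} h rewrite dec-true (k ℕ.<? 2 ^ w) h = refl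

  equal-refl : ∀ c → equal c c ≡ just true
  equal-refl (num x) = cong just (dec-true (x ℕ.≟ x) refl)
  equal-refl (chr a) = cong just (dec-true (a ≟ a) refl)

  run-halt : ∀ {s} → fetch P (pc s) ≡ just halt → Post s → Run s 1
  run-halt f q = 1 , _ , stop f , s≤s z≤n , q

  run-const : ∀ {s b r k} → fetch P (pc s) ≡ just (const r k) → k < 2 ^ w →
              Run (setReg r (num k) s) b → Run s (suc b)
  run-const {s} {r = r} {k} f h = tick e
    where
    e : step P s ≡ just (setReg r (num k) s)
    e rewrite f | word-fits h = refl

  run-move : ∀ {s b r i} → fetch P (pc s) ≡ just (move r i) →
             Run (setReg r (reg s i) s) b → Run s (suc b)
  run-move {s} {r = r} {i} f = tick e
    where
    e : step P s ≡ just (setReg r (reg s i) s)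
    e rewrite f = refl

  run-add : ∀ {s b r i j x y z} → fetch P (pc s) ≡ just (add r i j) →
            reg s i ≡ num x → reg s j ≡ num y → x + y ≡ z → z < 2 ^ w →
            Run (setReg r (num z) s) b → Run s (suc b)
  run-add {s} {r = r} {z = z} f p q refl h = tick e
    where
    e : step P s ≡ just (setReg r (num z) s)
    e rewrite f | p | q | word-fits h = refl

  run-sub : ∀ {s b r i j x y} → fetch P (pc s) ≡ just (sub r i j) →
            reg s i ≡ num x → reg s j ≡ num y → x ∸ y < 2 ^ w →
            Run (setReg r (num (x ∸ y)) s) b → Run s (suc b)
  run-sub {s} {r = r} {x = x} {y} f p q h = tick e
    where
    e : step P s ≡ just (setReg r (num (x ∸ y)) s)
    e rewrite f | p | q | word-fits h = refl

  run-load : ∀ {s b r i a} → fetch P (pc s) ≡ just (load r i) → reg s i ≡ num a →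
             Run (setReg r (mem s a) s) b → Run s (suc b)
  run-load {s} {r = r} {a = a} f p = tick e
    where
    e : step P s ≡ just (setReg r (mem s a) s)
    e rewrite f | p = refl

  run-store : ∀ {s b r i a} → fetch P (pc s) ≡ just (store i r) → reg s i ≡ num a →
              Run (setMem a (reg s r) s) b → Run s (suc b)
  run-store {s} {r = r} {a = a} f p = tick e
    where
    e : step P s ≡ just (setMem a (reg s r) s)
    e rewrite f | p = refl

  run-jump : ∀ {s b l} → fetch P (pc s) ≡ just (jump l) →
             Run (goto l s) b → Run s (suc b)
  run-jump {s} {l = l} f = tick e
    where
    e : step P s ≡ just (goto l s)
    e rewrite f = refl

  run-jeq-taken : ∀ {s b i j l c} → fetch P (pc s) ≡ just (jeq i j l) →
                  reg s i ≡ c → reg s j ≡ c →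
                  Run (goto l s) b → Run s (suc b)
  run-jeq-taken {s} {l = l} {c} f p q = tick e
    where
    e : step P s ≡ just (goto l s)
    e rewrite f | p | q | equal-refl c = refl

  run-jeq-num : ∀ {s b i j l x y} → fetch P (pc s) ≡ just (jeq i j l) →
                reg s i ≡ num x → reg s j ≡ num y → x ≢ y →
                Run (goto (suc (pc s)) s) b → Run s (suc b)
  run-jeq-num {s} {x = x} {y} f p q x≢y = tick e
    where
    e : step P s ≡ just (goto (suc (pc s)) s)
    e rewrite f | p | q | dec-false (x ℕ.≟ y) x≢y = refl

  run-jeq-chr : ∀ {s b i j l x y} → fetch P (pc s) ≡ just (jeq i j l) →
                reg s i ≡ chr x → reg s j ≡ chr y → x ≢ y →
                Run (goto (suc (pc s)) s) b → Run s (suc b)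
  run-jeq-chr {s} {x = x} {y} f p q x≢y = tick e
    where
    e : step P s ≡ just (goto (suc (pc s)) s)
    e rewrite f | p | q | dec-false (x ≟ y) x≢y = refl

-- The program

lenA lenB one nil posA posB posT end tmp chA chB : ℕ
lenA = 0
lenB = 1
one  = 2
nil  = 3
posA = 4
posB = 5
posT = 6
end  = 7
tmp  = 8
chA  = 9
chB  = 10

-- F k is kept at address |A| + |B| + k.  In the first two loops posA, posB and
-- posT hold j, |A| + k and |A| + |B| + k; the copying loop moves B[k..] down to
-- address j, behind A[..j].
glueProgram : Program
glueProgram =
    const one 1                --  0
  ∷ const nil 0
  ∷ move posA lenA
  ∷ add end lenA lenB
  ∷ move posB end
  ∷ add posT end lenB
  ∷ store posT posA            --  6: tabulate F
  ∷ jeq posB lenA 18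
  ∷ sub posB posB one
  ∷ sub posT posT one
  ∷ jeq posA nil 6             -- 10
  ∷ sub tmp posA one
  ∷ load chA tmp
  ∷ load chB posB
  ∷ jeq chA chB 16
  ∷ jump 6
  ∷ move posA tmp              -- 16
  ∷ jump 6
  ∷ const posA 0               -- 18
  ∷ load tmp posT              -- 19: increase j up to F k
  ∷ jeq posA tmp 30
  ∷ jeq posB end 25
  ∷ load chA posA
  ∷ load chB posB
  ∷ jeq chA chB 27
  ∷ add posA posA one          -- 25
  ∷ jump 19
  ∷ add posB posB one          -- 27
  ∷ add posT posT one
  ∷ jump 25
  ∷ jeq posB end 36            -- 30: copy
  ∷ load chB posB
  ∷ store posA chB
  ∷ add posA posA one
  ∷ add posB posB one
  ∷ jump 30
  ∷ move lenA posA             -- 36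
  ∷ const lenB 0
  ∷ halt
  ∷ []

-- A round of the copying loop takes 6 instructions; the final test and the closing instructions
-- take 4. With `l` on the left of the product, the bound for `suc l` unfolds definitionally.
copyTime : ℕ → ℕ
copyTime l = l * 6 + 4

-- In each of the first two loops the longest round takes 11 instructions. Leaving the second takes
-- 2. The 9 are the six initial instructions and the last store, the exit test and the reset of
-- `posA` in the first loop.
walkTime totalTime : ℕ → ℕ → ℕ
walkTime  m l = m * 11 + (2 + copyTime l)
totalTime m l = 9 + (l * 11 + walkTime m l)

-- Correctness and running time of the program

module Correctness {Σ : Set} (_≟_ : DecidableEquality Σ) (w : ℕ) (A B : List Σ)
  (fits : length A + length B + length B < 2 ^ w) (1-fits : 1 < 2 ^ w) where

  open Machine _≟_ w
  open Greedy _≟_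
  open Execution _≟_ w glueProgram
    (λ s → ∃[ C ] (HasOutput s C × MinimalCommonSupersequence A B C))

  m l : ℕ
  m = length A
  l = length B

  -- This is F k as a function of B[k..]: the unmatched rest of `reverse A` is A[..j] reversed, so
  -- its length is j.
  F : List Σ → ℕ
  F Q = length (proj₁ (embed (reverse A) Q))

  record Registers (ρ : ℕ → Cell Σ) (a b t : ℕ) : Set where
    field
      rA    : ρ posA ≡ num a
      rB    : ρ posB ≡ num b
      rT    : ρ posT ≡ num t
      r1    : ρ one  ≡ num 1
      r0    : ρ nil  ≡ num 0
      rLen  : ρ lenA ≡ num m
      rEnd  : ρ end  ≡ num (m + l)

  -- Unlike in `Stored`, the right part may be empty, since the empty suffix of `B` has a table
  -- entry too.
  Tabulated : (ℕ → Cell Σ) → ℕ → Set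
  Tabulated μ k = ∀ xs {ys} → xs ʳ++ ys ≡ B → k ≤ length xs →
                  μ (length xs + (m + l)) ≡ num (F ys)

  F≤m : ∀ Q → F Q ≤ m
  F≤m Q = subst (F Q ≤_)
    (trans (length-zipper (proj₂ (embed (reverse A) Q)) splits) (length-reverse A))
    (ℕ.m≤n+m _ _)
    where open Matched (embed-matched (reverse A) Q refl)

  fits-A : ∀ {k} → k ≤ m → k < 2 ^ w
  fits-A k≤m = ℕ.≤-<-trans (ℕ.≤-trans k≤m (ℕ.≤-trans (ℕ.m≤m+n m l) (ℕ.m≤m+n (m + l) l))) fits

  -- The address of the last table entry, where `posT` starts, is exactly the number bounded by
  -- `fits`.
  fits-T : ∀ {k} → k ≤ l → k + (m + l) < 2 ^ w
  fits-T {k} k≤l = ℕ.≤-<-trans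
    (ℕ.≤-trans (ℕ.+-monoˡ-≤ (m + l) k≤l) (ℕ.≤-reflexive (ℕ.+-comm l (m + l)))) fits

  fits-B : ∀ {k} → k ≤ l → k + m < 2 ^ w
  fits-B {k} k≤l = ℕ.≤-<-trans (ℕ.+-monoʳ-≤ k (ℕ.m≤m+n m l)) (fits-T k≤l)

  B-end : ∀ Bp → Bp ʳ++ [] ≡ B → length Bp + m ≡ m + l
  B-end Bp eq = trans (ℕ.+-comm _ m)
    (cong (m +_) (trans (sym (ℕ.+-identityʳ _)) (length-zipper Bp eq)))

  B-before-end : ∀ Bp {y ys} → Bp ʳ++ y ∷ ys ≡ B → length Bp + m ≢ m + l
  B-before-end Bp eq p = ℕ.<⇒≢ (length-left-∷ Bp eq)
    (ℕ.+-cancelʳ-≡ m _ _ (trans p (ℕ.+-comm m l)))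

  -- Source and target may overlap. Since the write address `length D` never exceeds the read
  -- address `length Bp + m`, a write destroys no character that is still to be read.
  copy : ∀ {C} → MinimalCommonSupersequence A B C → ∀ Bt D Bp ρ μ →
         D ʳ++ Bt ≡ C → Bp ʳ++ Bt ≡ B →
         length D ≤ length Bp + m →
         ρ posA ≡ num (length D) → ρ posB ≡ num (length Bp + m) →
         ρ one ≡ num 1 → ρ end ≡ num (m + l) →
         (∀ xs {y ys} → xs ʳ++ y ∷ ys ≡ C → length xs < length D →
            μ (length xs + 0) ≡ chr y) →
         (∀ xs {y ys} → xs ʳ++ y ∷ ys ≡ B → length Bp ≤ length xs →
            μ (length xs + m) ≡ chr y) →
         Run ⟨ 30 , ρ , μ ⟩ (copyTime (length Bt))
  copy {C} min [] D Bp ρ μ eqC eqB D≤B rA rB r1 rEnd done todo =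
    run-jeq-taken refl rB (trans rEnd (cong num (sym (B-end Bp eqB))))
    (run-move refl
    (run-const refl (fits-A z≤n)
    (run-halt refl
      (C , (trans rA (cong num D≡C) , 0 , refl , stored-lookup {μ = μ} written) , min))))
    where
    D≡C : length D ≡ length C
    D≡C = trans (sym (ℕ.+-identityʳ _)) (length-zipper D eqC)
    written : Stored μ 0 C
    written xs eq = done xs eq (subst (length xs <_) (sym D≡C) (length-left-∷ xs eq))
  copy {C} min (b ∷ Bt) D Bp ρ μ eqC eqB D≤B rA rB r1 rEnd done todo =
    run-jeq-num refl rB rEnd (B-before-end Bp eqB)
    (run-load refl rB
    (run-store refl rA
    (run-add refl rA r1 (ℕ.+-comm _ 1) (ℕ.≤-<-trans (s≤s D≤B) (fits-B Bp<l))
    (run-add refl rB r1 (ℕ.+-comm _ 1) (fits-B Bp<l)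
    (run-jump refl
    (copy min Bt (b ∷ D) (b ∷ Bp) _ _ eqC eqB (s≤s D≤B) refl refl r1 rEnd done′ todo′))))))
    where
    Bp<l = length-left-∷ Bp eqB
    μ′ = μ [ length D ≔ μ (length Bp + m) ]

    done′ : ∀ xs {y ys} → xs ʳ++ y ∷ ys ≡ C → length xs < suc (length D) →
            μ′ (length xs + 0) ≡ chr y
    done′ xs eq xs<D with length xs ℕ.≟ length D
    ... | yes same = trans
      (≔-here μ (trans (sym same) (sym (ℕ.+-identityʳ _))))
      (trans (todo Bp eqB ℕ.≤-refl)
             (cong chr (∷-injectiveˡ (ʳ++-injectiveʳ D xs (sym same) (trans eqC (sym eq))))))
    ... | no differ = trans
      (≔-there μ λ p → differ (sym (trans p (ℕ.+-identityʳ _))))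
      (done xs eq (ℕ.≤∧≢⇒< (ℕ.≤-pred xs<D) differ))

    todo′ : ∀ xs {y ys} → xs ʳ++ y ∷ ys ≡ B → suc (length Bp) ≤ length xs →
            μ′ (length xs + m) ≡ chr y
    todo′ xs eq Bp<xs = trans
      (≔-there μ (ℕ.<⇒≢ (ℕ.≤-<-trans D≤B (ℕ.+-monoˡ-< m Bp<xs))))
      (todo xs eq (ℕ.<⇒≤ Bp<xs))

  -- Here `D` is A[..j] reversed, so folding over it matches `B` greedily from left to right; `Bp`
  -- is B[..k] reversed and `Bt` is B[k..]. The recursion is on `At`, the rest of `A`.
  walk : ∀ At D Bt Bp ρ μ → D ʳ++ At ≡ A → embed B D ≡ (Bt , Bp) → length D ≤ F Bt →
         Registers ρ (length D) (length Bp + m) (length Bp + (m + l)) →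
         Stored μ 0 A → Stored μ m B →
         Tabulated μ 0 →
         Run ⟨ 19 , ρ , μ ⟩ (length At * 11 + (2 + copyTime l))
  walk At D Bt Bp ρ μ eqA emb D≤F regs stA stB table with length D ℕ.≟ F Bt
  ... | yes D≡F = relax (length At * 11)
    (run-load refl rT
    (run-jeq-taken refl rA (trans (table Bp splits z≤n) (cong num (sym D≡F)))
    (weaken (ℕ.+-monoˡ-≤ 4 (ℕ.*-monoˡ-≤ 6 Bt≤l))
    (copy minimal Bt D Bp _ _ refl splits D≤B rA rB r1 rEnd
       -- A[..j] already stands at addresses below j, so only B[k..] has to be moved.
       (λ xs eq xs<D → stA xs (trans (proj₂ (ʳ++-replace xs D xs<D eq)) eqA))
       (λ xs eq _ → stB xs eq)))))
    where
    open Registers regs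
    matched : Matched B D Bt Bp
    matched = embed-matched B D emb
    open Matched matched
    minimal = minimal-at-fixpoint D Bt eqA matched (embed-matched (reverse A) Bt refl) D≡F
    Bt≤l : length Bt ≤ l
    Bt≤l = subst (length Bt ≤_) (length-zipper Bp splits) (ℕ.m≤n+m _ _)
    D≤B : length D ≤ length Bp + m
    D≤B = ℕ.≤-trans (length-left D eqA) (ℕ.m≤n+m m _)
  -- With `A` exhausted j is `m`, which bounds F from above, so j = F k was reached.
  walk [] D Bt Bp ρ μ eqA emb D≤F regs stA stB table | no D≢F =
    ⊥-elim (D≢F (ℕ.≤-antisym D≤F (begin
      F Bt                 ≤⟨ F≤m Bt ⟩
      m                    ≡⟨ length-zipper D eqA ⟨
      length D + 0         ≡⟨ ℕ.+-identityʳ _ ⟩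
      length D             ∎)))
    where open ≤-Reasoning
  walk (a ∷ At) D Bt Bp ρ μ eqA emb D≤F regs stA stB table | no D≢F =
    run-load refl rT
    (run-jeq-num refl rA (table Bp splits z≤n) D≢F
    (cont Bt emb splits (ℕ.≤∧≢⇒< D≤F D≢F)))
    where
    open Registers regs
    open Matched (embed-matched B D emb) using (splits)
    μF = μ (length Bp + (m + l))
    D<m = length-left-∷ D eqA

    cont : ∀ Bt → embed B D ≡ (Bt , Bp) → Bp ʳ++ Bt ≡ B → length D < F Bt →
           Run ⟨ 21 , ρ [ tmp ≔ μF ] , μ ⟩ (9 + (length At * 11 + (2 + copyTime l)))
    cont [] emb eqB D<F =
      run-jeq-taken refl rB (trans rEnd (cong num (sym (B-end Bp eqB))))
      (run-add refl rA r1 (ℕ.+-comm _ 1) (fits-A D<m)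
      (run-jump refl
      (relax 6
      (walk At (a ∷ D) [] Bp _ _ eqA (cong (consume a) emb) D<F
        (record { rA = refl ; rB = rB ; rT = rT ; r1 = r1 ; r0 = r0 ; rLen = rLen ; rEnd = rEnd })
        stA stB table))))
    cont (y ∷ Bt) emb eqB D<F =
      run-jeq-num refl rB rEnd (B-before-end Bp eqB)
      (run-load refl rA
      (run-load refl rB
      (compare (y ≟ a))))
      where
      atA : μ (length D) ≡ chr a
      atA = trans (cong μ (sym (ℕ.+-identityʳ _))) (stA D eqA)
      atB : μ (length Bp + m) ≡ chr y
      atB = stB Bp eqB
      Bp<l = length-left-∷ Bp eqB
      ρ′ = ((ρ [ tmp ≔ μF ]) [ chA ≔ μ (length D) ]) [ chB ≔ μ (length Bp + m) ]

      compare : Dec (y ≡ a) →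
                Run ⟨ 24 , ρ′ , μ ⟩ (6 + (length At * 11 + (2 + copyTime l)))
      compare (yes y≡a) =
        run-jeq-taken refl atA (trans atB (cong chr y≡a))
        (run-add refl rB r1 (ℕ.+-comm _ 1) (fits-B Bp<l)
        (run-add refl rT r1 (ℕ.+-comm _ 1) (fits-T Bp<l)
        (run-jump refl
        (run-add refl rA r1 (ℕ.+-comm _ 1) (fits-A D<m)
        (run-jump refl
        (walk At (a ∷ D) Bt (y ∷ Bp) _ _ eqA
          (trans (cong (consume a) emb) (consume-match y≡a))
          -- Both j and k advance: j + 1 ≤ F k ≤ F (k + 1).
          (ℕ.≤-trans D<F (embed-∷-shrinks (reverse A) y Bt))
          (record { rA = refl ; rB = refl ; rT = refl ; r1 = r1 ; r0 = r0 ; rLen = rLen ; rEnd = rEnd })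
          stA stB table))))))
      compare (no y≢a) =
        run-jeq-chr refl atA atB (≢-sym y≢a)
        (run-add refl rA r1 (ℕ.+-comm _ 1) (fits-A D<m)
        (run-jump refl
        (relax 3
        (walk At (a ∷ D) (y ∷ Bt) Bp _ _ eqA
          (trans (cong (consume a) emb) (consume-skip y≢a)) D<F
          (record { rA = refl ; rB = rB ; rT = rT ; r1 = r1 ; r0 = r0 ; rLen = rLen ; rEnd = rEnd })
          stA stB table))))

  tabulated-≔ : ∀ Bp {Bt μ v} → Bp ʳ++ Bt ≡ B → v ≡ num (F Bt) →
                Tabulated μ (suc (length Bp)) →
                Tabulated (μ [ length Bp + (m + l) ≔ v ]) (length Bp)
  tabulated-≔ Bp {μ = μ} eqB v≡ table xs eq Bp≤xs with length xs ℕ.≟ length Bp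
  ... | yes same = trans (≔-here μ (cong (_+ (m + l)) (sym same)))
    (trans v≡ (cong (num ∘ F) (ʳ++-injectiveʳ Bp xs (sym same) (trans eqB (sym eq)))))
  ... | no differ = trans (≔-there μ (≢-sym differ ∘ ℕ.+-cancelʳ-≡ (m + l) _ _))
    (table xs eq (ℕ.≤∧≢⇒< Bp≤xs (≢-sym differ)))

  -- The pair `R`, `M` is the state of the right-to-left matching, and `posA` holds the current F k.
  -- The store is common to all cases and is separated from the case distinction in `tabulate-next`.
  tabulate : ∀ Bp Bt R M ρ μ → Bp ʳ++ Bt ≡ B → embed (reverse A) Bt ≡ (R , M) →
             Registers ρ (length R) (length Bp + m) (length Bp + (m + l)) →
             Stored μ 0 A → Stored μ m B → Tabulated μ (suc (length Bp)) →
             Run ⟨ 6 , ρ , μ ⟩ (3 + (length Bp * 11 + walkTime m l))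

  tabulate-next : ∀ Bp Bt R M ρ μ → Bp ʳ++ Bt ≡ B → embed (reverse A) Bt ≡ (R , M) →
                  Registers ρ (length R) (length Bp + m) (length Bp + (m + l)) →
                  Stored μ 0 A → Stored μ m B → Tabulated μ (length Bp) →
                  Run ⟨ 7 , ρ , μ ⟩ (2 + (length Bp * 11 + walkTime m l))

  tabulate Bp Bt R M ρ μ eqB emb regs stA stB table =
    run-store refl rT
    (tabulate-next Bp Bt R M _ _ eqB emb regs
      -- The table begins at `m + l`, behind both strings.
      (stored-≔ {μ = μ} A (ℕ.≤-trans (ℕ.+-monoʳ-≤ m z≤n) (ℕ.m≤n+m (m + l) (length Bp))) stA)
      (stored-≔ {μ = μ} B (ℕ.≤-trans (ℕ.≤-reflexive (ℕ.+-comm l m)) (ℕ.m≤n+m (m + l) (length Bp))) stB)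
      (tabulated-≔ Bp {μ = μ} eqB (trans rA (cong (num ∘ length ∘ proj₁) (sym emb))) table))
    where open Registers regs

  tabulate-next [] Bt R M ρ μ eqB emb regs stA stB table =
    run-jeq-taken refl rB rLen
    (run-const refl (fits-A z≤n)
    -- The scan leaves `posB` and `posT` at k = 0, where the second loop begins; only j had to be
    -- reset.
    (walk A [] B [] _ _ refl refl z≤n
      (record { rA = refl ; rB = rB ; rT = rT ; r1 = r1 ; r0 = r0 ; rLen = rLen ; rEnd = rEnd })
      stA stB table))
    where open Registers regs
  -- All of `A` is matched, so F stays 0; the test against `nil` avoids looking for a character
  -- before address 0.
  tabulate-next (b ∷ Bp) Bt [] M ρ μ eqB emb regs stA stB table =
    run-jeq-num refl rB rLen (≢-sym (ℕ.m≢1+n+m m))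
    (run-sub refl rB r1 (fits-B (ℕ.<⇒≤ (length-left-∷ Bp eqB)))
    (run-sub refl rT r1 (fits-T (ℕ.<⇒≤ (length-left-∷ Bp eqB)))
    (run-jeq-taken refl rA r0
    (relax 6
    (tabulate Bp (b ∷ Bt) [] M _ _ eqB (cong (consume b) emb)
      (record { rA = rA ; rB = refl ; rT = refl ; r1 = r1 ; r0 = r0 ; rLen = rLen ; rEnd = rEnd })
      stA stB table)))))
    where open Registers regs
  tabulate-next (b ∷ Bp) Bt (x ∷ R) M ρ μ eqB emb regs stA stB table =
    run-jeq-num refl rB rLen (≢-sym (ℕ.m≢1+n+m m))
    (run-sub refl rB r1 (fits-B (ℕ.<⇒≤ (length-left-∷ Bp eqB)))
    (run-sub refl rT r1 (fits-T (ℕ.<⇒≤ (length-left-∷ Bp eqB)))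
    (run-jeq-num refl rA r0 ℕ.1+n≢0
    (run-sub refl rA r1 (fits-A (ℕ.<⇒≤ (length-left-∷ R eqA)))
    (run-load refl refl
    (run-load refl refl
    (compare (x ≟ b))))))))
    where
    open Registers regs
    open Matched (embed-matched (reverse A) Bt emb) using (splits)
    eqA : R ʳ++ x ∷ M ≡ A
    eqA = ʳ++-flip M splits
    atA : μ (length R) ≡ chr x
    atA = trans (cong μ (sym (ℕ.+-identityʳ _))) (stA R eqA)
    atB : μ (length Bp + m) ≡ chr b
    atB = stB Bp eqB
    ρ₁ = (ρ [ posB ≔ num (length Bp + m) ]) [ posT ≔ num (length Bp + (m + l)) ]
    ρ′ = ((ρ₁ [ tmp ≔ num (length R) ]) [ chA ≔ μ (length R) ]) [ chB ≔ μ (length Bp + m) ]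

    compare : Dec (x ≡ b) →
              Run ⟨ 14 , ρ′ , μ ⟩ (3 + (3 + (length Bp * 11 + walkTime m l)))
    compare (yes x≡b) =
      run-jeq-taken refl atA (trans atB (cong chr (sym x≡b)))
      (run-move refl
      (run-jump refl
      (tabulate Bp (b ∷ Bt) R (x ∷ M) _ _ eqB (trans (cong (consume b) emb) (consume-match x≡b))
        (record { rA = refl ; rB = refl ; rT = refl ; r1 = r1 ; r0 = r0 ; rLen = rLen ; rEnd = rEnd })
        stA stB table)))
    compare (no x≢b) =
      run-jeq-chr refl atA atB x≢b
      (run-jump refl
      (relax 1
      (tabulate Bp (b ∷ Bt) (x ∷ R) M _ _ eqB (trans (cong (consume b) emb) (consume-skip x≢b))
        (record { rA = rA ; rB = refl ; rT = refl ; r1 = r1 ; r0 = r0 ; rLen = rLen ; rEnd = rEnd })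
        stA stB table)))

  correct : Run (input A B) (totalTime m l)
  correct =
    run-const refl 1-fits
    (run-const refl (fits-A z≤n)
    (run-move refl
    (run-add refl refl refl refl m+l-fits
    (run-move refl
    (run-add refl refl refl (ℕ.+-comm _ l) (fits-T ℕ.≤-refl)
    (weaken (ℕ.≤-reflexive (cong (λ k → 3 + (k * 11 + walkTime m l)) (length-reverse B)))
    (tabulate (reverse B) [] (reverse A) [] _ _ (ʳ++-flip [] refl) refl
      (record { rA = cong num (sym (length-reverse A))
              ; rB = cong num (trans (ℕ.+-comm m l) (cong (_+ m) (sym (length-reverse B))))
              ; rT = cong (λ k → num (k + (m + l))) (sym (length-reverse B))
              ; r1 = refl ; r0 = refl ; rLen = refl ; rEnd = refl })
      (stored-left A B) (stored-right A B)
      -- The table is still empty, and no prefix of `B` is longer than `B`.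
      (λ xs eq over → ⊥-elim (ℕ.<⇒≱ over
        (subst (length xs ≤_) (sym (length-reverse B)) (length-left xs eq)))))))))))
    where
    m+l-fits : m + l < 2 ^ w
    m+l-fits = fits-T {0} z≤n

-- The linear time bound and the word size

totalTime-mono : ∀ {m l n} → m ≤ n → l ≤ n → totalTime m l ≤ totalTime n n
totalTime-mono m≤n l≤n =
  ℕ.+-monoʳ-≤ 9 (ℕ.+-mono-≤ (ℕ.*-monoˡ-≤ 11 l≤n)
    (ℕ.+-mono-≤ (ℕ.*-monoˡ-≤ 11 m≤n) (ℕ.+-monoʳ-≤ 2 (ℕ.+-monoˡ-≤ 4 (ℕ.*-monoˡ-≤ 6 l≤n)))))

totalTime-linear : (λ n → totalTime n n) ∈O (λ n → n)
-- The three loops contribute 11 + 11 + 6 = 28 per unit of `n` and the rest is 9 + 2 + 4 = 15; from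
-- `n = 1` on, 15 is at most `15 * n`.
totalTime-linear = 43 , 1 , λ n 1≤n → begin
  totalTime n n     ≡⟨ solve 1 (λ n → con 9 :+ (n :* con 11 :+
                         (n :* con 11 :+ (con 2 :+ (n :* con 6 :+ con 4))))
                         := con 28 :* n :+ con 15 :* con 1) refl n ⟩
  28 * n + 15 * 1   ≤⟨ ℕ.+-monoʳ-≤ (28 * n) (ℕ.*-monoʳ-≤ 15 1≤n) ⟩
  28 * n + 15 * n   ≡⟨ ℕ.*-distribʳ-+ n 28 15 ⟨
  43 * n            ∎
  where
  open ≤-Reasoning
  open +-*-Solver

mainTheorem5 : ∃[ P ] ∃[ T ] ∃[ d ]
    (T ∈O (λ n → n) ×
    ((Σ : Set) (_≟_ : DecidableEquality Σ) (n w : ℕ) (A B : List Σ) →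
    length A ≤ n → length B ≤ n → d * suc n ≤ 2 ^ w →
    ∃[ t ] ∃[ s ] ∃[ C ]
    (Machine._⊢_⇓[_]_ _≟_ w P (input A B) t s ×
    t ≤ T n ×
    HasOutput s C ×
    MinimalCommonSupersequence A B C)))
-- The factor 3 comes from |A| + 2|B| ≤ 3n. Having `suc n` makes this strict and, even for `n = 0`,
-- leaves room for the literal 1.
mainTheorem5 = glueProgram , (λ n → totalTime n n) , 3 , totalTime-linear ,
  λ Σ _≟_ n w A B A≤n B≤n room →
    let fits : length A + length B + length B < 2 ^ w
        fits = begin-strict
          length A + length B + length B  ≤⟨ ℕ.+-mono-≤ (ℕ.+-mono-≤ A≤n B≤n) B≤n ⟩
          n + n + n                       ≡⟨ solve 1 (λ n → n :+ n :+ n := con 3 :* n) refl n ⟩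
          3 * n                           <⟨ ℕ.*-monoʳ-< 3 (ℕ.n<1+n n) ⟩
          3 * suc n                       ≤⟨ room ⟩
          2 ^ w                           ∎
        1-fits : 1 < 2 ^ w
        1-fits = ℕ.<-≤-trans (s≤s (s≤s z≤n)) (ℕ.≤-trans (ℕ.*-monoʳ-≤ 3 (s≤s (z≤n {n}))) room)
        t , s , run , t≤ , C , out , min = Correctness.correct _≟_ w A B fits 1-fits
    in t , s , C , run , ℕ.≤-trans t≤ (totalTime-mono A≤n B≤n) , out , min
  where
  open ≤-Reasoning
  open +-*-Solver
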